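{- Let $(\vec f,\vec\theta,\forall\vec x.\,\phi,\vec{\mathcal J}\uplus\vec{\mathcal I})$ be a SyMO problem over a background theory $T$ such that $\vec{\mathcal J}$ is a set of oracle interfaces defining the oracle function symbols $\vec\theta$ (one interface per symbol), and every interface in $\vec{\mathcal I}$ has an empty (trivially true) assumption generator. If Algorithm 2 (described in the context) returns a tuple of functions $\vec f^*$, then $\vec f^*$ is a solution of the SyMO problem. That is, $(\vec x,\vec\theta,\neg\phi\cdot\{\vec f\to\vec f^*\},\vec{\mathcal J}\uplus\vec{\mathcal I})$ is unsatisfiable modulo theories and oracles.
   Context: Notation: for an expression $e$ with a free variable $x$, $e\cdot\{x\to t\}$ denotes proper substitution of $x$ by $t$. The symbol $\approx$ denotes equality. An oracle interface is a tuple $\mathcal I=(\vec y,\vec z,\alpha_{gen},\beta_{gen})$, where $\vec y$ (the query domain) and $\vec z$ (the response co-domain) are lists of sorted variables, and $\alpha_{gen}$ (the assumption generator) and $\beta_{gen}$ (the constraint generator) are formulas whose free variables are among $\vec y,\vec z$. Each oracle interface has an associated oracle, which on a tuple of values $\vec c$ of the sorts of $\vec y$ returns a tuple of values $\vec d$ of the sorts of $\vec z$. If calling the oracle on $\vec c$ returns $\vec d$, then $\alpha_{gen}\cdot\{\vec y\to\vec c,\vec z\to\vec d\}$ is an assumption generated by $\mathcal I$, and $\beta_{gen}\cdot\{\vec y\to\vec c,\vec z\to\vec d\}$ is a constraint generated by $\mathcal I$. An SMTO problem is a tuple $(\vec f,\vec\theta,\rho,\vec{\mathcal I})$, where $\vec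 f$ are ordinary function symbols, $\vec\theta$ are oracle function symbols, $\rho$ is a formula in a background theory $T$ whose free function symbols are $\vec f\uplus\vec\theta$, and $\vec{\mathcal I}$ is a set of oracle interfaces. It is unsatisfiable if $\exists\vec f.\exists\vec\theta.\,A\wedge\rho\wedge B$ is $T$-unsatisfiable for some conjunctions $A$ of generated assumptions and $B$ of generated constraints. An oracle interface $\mathcal J$ defines an oracle function symbol $\theta$ if it has the form $((y_1,\dots,y_j),(z),\ \theta(y_1,\dots,y_j)\approx z,\ \text{true})$ and its associated oracle is functional. A SyMO problem is a tuple $(\vec f,\vec\theta,\forall\vec x.\,\phi,\vec{\mathcal I})$, where $\vec f$ is a tuple of functions to synthesize, $\vec\theta$ are oracle function symbols, $\phi$ is a quantifier-free formula in $T$, and $\vec{\mathcal I}$ is a set of oracle interfaces. A tuple of functions $\vec f^*$ is a solution if the SMTO problem $(\vec x,\vec\theta,\neg\phi\cdot\{\vec f\to\vec f^*\},\vec{\mathcal I})$ is unsatisfiable. Algorithm 1 (SMTO), used as a subroutine. Its input is a Definitional SMTO problem $(\vec g,\vec\theta,\rho,\vec{\mathcal J})$, meaning each $\theta_i$ is defined by $\mathcal J_i$. Initialize $A:=\text{true}$ and repeat the following: 1. Call an SMT solver on $\rho\wedge A$, with $\vec\theta$ uninterpreted. If the result is UNSAT, return (UNSAT, $A$). 2. Otherwise take its model $M$ and set $\mu:=\langle\rho\cdot\{\vec g\to\vec g^M\}\rangle$. Here $\langle\cdot\rangle$ is partial evaluation of ground subterms built from interpreted symbols applied to values. 3. While $\mu$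 contains a subterm $\theta_i(\vec c)$ with $\vec c$ values, replace it by $d$, where $\theta_i(\vec c)\approx d\in A$ if such an entry exists; otherwise $d$ is obtained by calling the oracle of $\mathcal J_i$ on $\vec c$ and $\theta_i(\vec c)\approx d$ is added to $A$. Then partially evaluate $\mu$. 4. If $\mu$ is true, return (SAT, $A$, $M$ restricted to $\vec g$). Algorithm 2 (Synthesis Modulo Oracles). Its input is $(\vec f,\vec\theta,\forall\vec x.\,\phi,\vec{\mathcal J}\uplus\vec{\mathcal I})$. Initialize $A:=\text{true}$ and $S:=\text{true}$ (both conjunctions of formulas) and repeat the following: 1. Let $\vec f^*$ be any tuple of functions satisfying $S$; if none exists, return "no solution". 2. Let $V:=A\wedge\neg\phi$ and run Algorithm 1 on $(\vec x,\vec\theta,V\cdot\{\vec f\to\vec f^*\},\vec{\mathcal J})$, obtaining $(r,\alpha,M)$. If $r=$ UNSAT, return $\vec f^*$. 3. Otherwise obtain constraints $\beta$ by calling oracles of $\vec{\mathcal I}$ on some inputs. Set $A:=A\wedge\alpha$ and $S:=S\wedge\phi\cdot\{\vec x\to\vec x^M\}\wedge\beta$. -}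

module Defs where

open import Data.Bool using (Bool; true; false; T; not)
import Data.Bool as Bool
open import Data.List using (List; []; _∷_; _++_; foldr)
open import Data.List.Membership.Propositional using (_∈_; _∉_)
open import Data.List.Membership.Propositional.Properties
  using (∈-++⁺ˡ; ∈-++⁺ʳ; ∈-++⁻)
import Data.List.Membership.DecPropositional as DecMembership
open import Data.List.Relation.Unary.All as All using (All; []; _∷_)
import Data.List.Relation.Unary.All.Properties as All
open import Data.List.Relation.Unary.Any using (here; there)
open import Data.List.Relation.Unary.Unique.Propositional using (Unique; _∷_)
open import Data.List.Relation.Binary.Pointwise using (Pointwise; []; _∷_)
open import Data.Maybe using (Maybe; just; nothing; maybe′; zipWith; _>>=_)
open import Data.Product using (∃-syntax; Σ-syntax; _×_; _,_)
open import Data.Sum using (_⊎_; inj₁; inj₂)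
import Data.Unit as Unit
open import Function using (_∘_)
open import Relation.Binary.Definitions using (DecidableEquality)
open import Relation.Binary.PropositionalEquality using (_≡_; _≢_; refl)
open import Relation.Nullary using (¬_; yes; no; does; contradiction)

-- Many-sorted first-order logic with equality.  Every sort has a (possibly
-- empty) set of values, which are constant symbols of the signature.  A theory
-- that treats Bool as a sort has it among `Sort`, with its operations in `Op`.
record Signature : Set₁ where
  field
    Sort  : Set
    Op    : List Sort → Sort → Set
    Pred  : List Sort → Set
    Value : Sort → Set
    _≟ᵛ_  : ∀ {s} → DecidableEquality (Value s)

  Values : List Sort → Set
  Values = All Value

record Structure (𝒮 : Signature) : Set₁ where
  open Signature 𝒮
  field
    Carrier   : Sort → Set
    inhabited : ∀ s → Carrier s
    op        : ∀ {as s} → Op as s → All Carrier as → Carrier s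
    pred      : ∀ {as} → Pred as → All Carrier as → Set
    value     : ∀ {s} → Value s → Carrier s

-- A theory is a class of structures.  It comes with the partial evaluator of
-- interpreted symbols on values that ⟨_⟩ relies on; an evaluator may be
-- undefined anywhere, so its presence does not restrict the theory.
record Theory (𝒮 : Signature) : Set₂ where
  open Signature 𝒮
  open Structure
  field
    Model        : Structure 𝒮 → Set₁
    distinct     : ∀ {M} → Model M → ∀ {s} {c d : Value s} →
                   value M c ≡ value M d → c ≡ d
    evalOp       : ∀ {as s} → Op as s → Values as → Maybe (Value s)
    evalOp-sound : ∀ {M} → Model M → ∀ {as s} (o : Op as s) cs {d} →
                   evalOp o cs ≡ just d → op M o (All.map (value M) cs) ≡ value M d
    evalPred     : ∀ {as} → Pred as → Values as → Maybe Bool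
    evalPred-true  : ∀ {M} → Model M → ∀ {as} (p : Pred as) cs →
                     evalPred p cs ≡ just true → pred M p (All.map (value M) cs)
    evalPred-false : ∀ {M} → Model M → ∀ {as} (p : Pred as) cs →
                     evalPred p cs ≡ just false → ¬ pred M p (All.map (value M) cs)

-- The names of uninterpreted function symbols.  The tuples f⃗, θ⃗, x⃗ are lists
-- of such names; the variables x⃗ are names of arity zero.
record Symbols (𝒮 : Signature) : Set₁ where
  open Signature 𝒮
  field
    Symbol : Set
    _≟ˢ_   : DecidableEquality Symbol
    dom    : Symbol → List Sort
    cod    : Symbol → Sort

data Connective : Set where
  and or implies : Connective

data Quantifier : Set where
  forAll exists : Quantifier

applyᵇ : Connective → Bool → Bool → Bool
applyᵇ and     a b = a Bool.∧ b
applyᵇ or      a b = a Bool.∨ b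
applyᵇ implies a b = not a Bool.∨ b

module SMO {𝒮 : Signature} (𝒯 : Theory 𝒮) (𝒴 : Symbols 𝒮) where

  open Signature 𝒮 public
  open Theory 𝒯
  open Symbols 𝒴 public
  open DecMembership _≟ˢ_ using (_∈?_)

  infix  7 _≈_
  infixr 6 _∧_

  -- Γ lists the sorts of the (de Bruijn) variables: those bound by quantifiers,
  -- the parameters of λ-terms, and the variables y⃗, z⃗ of oracle interfaces.
  data Term (Γ : List Sort) : Sort → Set where
    var : ∀ {s} → s ∈ Γ → Term Γ s
    val : ∀ {s} → Value s → Term Γ s
    app : ∀ {as s} → Op as s → All (Term Γ) as → Term Γ s
    sym : (f : Symbol) → All (Term Γ) (dom f) → Term Γ (cod f)

  Args : List Sort → List Sort → Set
  Args Γ = All (Term Γ)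

  data Formula (Γ : List Sort) : Set where
    truth  : Bool → Formula Γ
    pred   : ∀ {as} → Pred as → Args Γ as → Formula Γ
    _≈_    : ∀ {s} → Term Γ s → Term Γ s → Formula Γ
    neg    : Formula Γ → Formula Γ
    binary : Connective → Formula Γ → Formula Γ → Formula Γ
    quant  : Quantifier → (s : Sort) → Formula (s ∷ Γ) → Formula Γ

  pattern ⊤       = truth true
  pattern _∧_ φ ψ = binary and φ ψ

  Sentence : Set
  Sentence = Formula []

  ⋀ : List Sentence → Sentence
  ⋀ = foldr _∧_ ⊤

  constants : ∀ {Γ as} → Values as → Args Γ as
  constants = All.map val

  mutual
    AllSymbolsᵗ : (Symbol → Set) → ∀ {Γ s} → Term Γ s → Set
    AllSymbolsᵗ P (var i)    = Unit.⊤
    AllSymbolsᵗ P (val c)    = Unit.⊤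
    AllSymbolsᵗ P (app o ts) = AllSymbolsᵃ P ts
    AllSymbolsᵗ P (sym f ts) = P f × AllSymbolsᵃ P ts

    AllSymbolsᵃ : (Symbol → Set) → ∀ {Γ as} → Args Γ as → Set
    AllSymbolsᵃ P []       = Unit.⊤
    AllSymbolsᵃ P (t ∷ ts) = AllSymbolsᵗ P t × AllSymbolsᵃ P ts

  AllSymbols : (Symbol → Set) → ∀ {Γ} → Formula Γ → Set
  AllSymbols P (truth b)      = Unit.⊤
  AllSymbols P (pred p ts)    = AllSymbolsᵃ P ts
  AllSymbols P (t ≈ u)        = AllSymbolsᵗ P t × AllSymbolsᵗ P u
  AllSymbols P (neg φ)        = AllSymbols P φ
  AllSymbols P (binary _ φ ψ) = AllSymbols P φ × AllSymbols P ψ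
  AllSymbols P (quant _ s φ)  = AllSymbols P φ

  QuantifierFree : ∀ {Γ} → Formula Γ → Set
  QuantifierFree (truth b)      = Unit.⊤
  QuantifierFree (pred p ts)    = Unit.⊤
  QuantifierFree (t ≈ u)        = Unit.⊤
  QuantifierFree (neg φ)        = QuantifierFree φ
  QuantifierFree (binary _ φ ψ) = QuantifierFree φ × QuantifierFree ψ
  QuantifierFree (quant _ _ φ)  = T false

  mutual
    instᵗ : ∀ {Γ Δ} → (∀ {s} → s ∈ Γ → Term Δ s) → ∀ {s} → Term Γ s → Term Δ s
    instᵗ σ (var i)    = σ i
    instᵗ σ (val c)    = val c
    instᵗ σ (app o ts) = app o (instᵃ σ ts)
    instᵗ σ (sym f ts) = sym f (instᵃ σ ts)

    instᵃ : ∀ {Γ Δ} → (∀ {s} → s ∈ Γ → Term Δ s) → ∀ {as} → Args Γ as → Args Δ as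
    instᵃ σ []       = []
    instᵃ σ (t ∷ ts) = instᵗ σ t ∷ instᵃ σ ts

  lift : ∀ {Γ Δ a} → (∀ {s} → s ∈ Γ → Term Δ s) →
         ∀ {s} → s ∈ (a ∷ Γ) → Term (a ∷ Δ) s
  lift σ (here eq) = var (here eq)
  lift σ (there i) = instᵗ (var ∘ there) (σ i)

  inst : ∀ {Γ Δ} → (∀ {s} → s ∈ Γ → Term Δ s) → Formula Γ → Formula Δ
  inst σ (truth b)      = truth b
  inst σ (pred p ts)    = pred p (instᵃ σ ts)
  inst σ (t ≈ u)        = instᵗ σ t ≈ instᵗ σ u
  inst σ (neg φ)        = neg (inst σ φ)
  inst σ (binary k φ ψ) = binary k (inst σ φ) (inst σ ψ)
  inst σ (quant q s φ)  = quant q s (inst (lift σ) φ)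

  -- The λ-term λ v⃗. body for the symbol f, mentioning only symbols of Δ.
  record Lambda (Δ : List Symbol) (f : Symbol) : Set where
    field
      body   : Term (dom f) (cod f)
      scoped : AllSymbolsᵗ (_∈ Δ) body
  open Lambda public

  mutual
    substᵗ : ∀ {Δ fs} → All (Lambda Δ) fs → ∀ {Γ s} → Term Γ s → Term Γ s
    substᵗ σ (var i)    = var i
    substᵗ σ (val c)    = val c
    substᵗ σ (app o ts) = app o (substᵃ σ ts)
    substᵗ {fs = fs} σ (sym g ts) with g ∈? fs
    ... | yes g∈fs = instᵗ (All.lookup (substᵃ σ ts)) (body (All.lookup σ g∈fs))
    ... | no  _    = sym g (substᵃ σ ts)

    substᵃ : ∀ {Δ fs} → All (Lambda Δ) fs → ∀ {Γ as} → Args Γ as → Args Γ as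
    substᵃ σ []       = []
    substᵃ σ (t ∷ ts) = substᵗ σ t ∷ substᵃ σ ts

  infixl 8 _·_

  _·_ : ∀ {Γ Δ fs} → Formula Γ → All (Lambda Δ) fs → Formula Γ
  truth b      · σ = truth b
  pred p ts    · σ = pred p (substᵃ σ ts)
  (t ≈ u)      · σ = substᵗ σ t ≈ substᵗ σ u
  neg φ        · σ = neg (φ · σ)
  binary k φ ψ · σ = binary k (φ · σ) (ψ · σ)
  quant q s φ  · σ = quant q s (φ · σ)

  Interpretation : Structure 𝒮 → Set
  Interpretation M = (f : Symbol) → All (Structure.Carrier M) (dom f) →
                     Structure.Carrier M (cod f)

  module Semantics (M : Structure 𝒮) (I : Interpretation M) where
    open Structure M using (Carrier; op; value) renaming (pred to predᴹ)

    mutual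
      ⟦_⟧ᵗ : ∀ {Γ s} → Term Γ s → All Carrier Γ → Carrier s
      ⟦ var i ⟧ᵗ    ρ = All.lookup ρ i
      ⟦ val c ⟧ᵗ    ρ = value c
      ⟦ app o ts ⟧ᵗ ρ = op o (⟦ ts ⟧ᵃ ρ)
      ⟦ sym f ts ⟧ᵗ ρ = I f (⟦ ts ⟧ᵃ ρ)

      ⟦_⟧ᵃ : ∀ {Γ as} → Args Γ as → All Carrier Γ → All Carrier as
      ⟦ [] ⟧ᵃ     ρ = []
      ⟦ t ∷ ts ⟧ᵃ ρ = ⟦ t ⟧ᵗ ρ ∷ ⟦ ts ⟧ᵃ ρ

    ⟦_⟧ : ∀ {Γ} → Formula Γ → All Carrier Γ → Set
    ⟦ truth b ⟧            ρ = T b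
    ⟦ pred p ts ⟧          ρ = predᴹ p (⟦ ts ⟧ᵃ ρ)
    ⟦ t ≈ u ⟧              ρ = ⟦ t ⟧ᵗ ρ ≡ ⟦ u ⟧ᵗ ρ
    ⟦ neg φ ⟧              ρ = ¬ ⟦ φ ⟧ ρ
    ⟦ binary and φ ψ ⟧     ρ = ⟦ φ ⟧ ρ × ⟦ ψ ⟧ ρ
    ⟦ binary or φ ψ ⟧      ρ = ⟦ φ ⟧ ρ ⊎ ⟦ ψ ⟧ ρ
    ⟦ binary implies φ ψ ⟧ ρ = ⟦ φ ⟧ ρ → ⟦ ψ ⟧ ρ
    ⟦ quant forAll s φ ⟧   ρ = (a : Carrier s) → ⟦ φ ⟧ (a ∷ ρ)
    ⟦ quant exists s φ ⟧   ρ = Σ[ a ∈ Carrier s ] ⟦ φ ⟧ (a ∷ ρ)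

  infix 4 _,_⊨_ _,_⊨∃[_]_

  _,_⊨_ : (M : Structure 𝒮) → Interpretation M → Sentence → Set
  M , I ⊨ ψ = Semantics.⟦_⟧ M I ψ []

  -- Second-order ∃ over the symbols gs: they may be reinterpreted.
  _,_⊨∃[_]_ : (M : Structure 𝒮) → Interpretation M → List Symbol → Sentence → Set
  M , I ⊨∃[ gs ] ψ =
    Σ[ I′ ∈ Interpretation M ]
      (∀ g → g ∉ gs → ∀ as → I′ g as ≡ I g as) × (M , I′ ⊨ ψ)

  Satisfiable : Sentence → Set₁
  Satisfiable ψ = Σ[ M ∈ Structure 𝒮 ] Model M × (Σ[ I ∈ Interpretation M ] M , I ⊨ ψ)

  ∃Satisfiable : List Symbol → Sentence → Set₁
  ∃Satisfiable gs ψ =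
    Σ[ M ∈ Structure 𝒮 ] Model M × (Σ[ I ∈ Interpretation M ] M , I ⊨∃[ gs ] ψ)

  -- `Returns c d`: calling the oracle on c may return d.
  record Oracle (ys zs : List Sort) : Set₁ where
    field
      Returns  : Values ys → Values zs → Set
      responds : ∀ c → ∃[ d ] Returns c d

    Functional : Set
    Functional = ∀ {c d d′} → Returns c d → Returns c d′ → d ≡ d′
  open Oracle public

  record Interface : Set₁ where
    field
      query      : List Sort
      response   : List Sort
      assumption : Formula (query ++ response)
      constraint : Formula (query ++ response)
      oracle     : Oracle query response
  open Interface public

  _[_,_] : ∀ {ys zs} → Formula (ys ++ zs) → Values ys → Values zs → Sentence
  ψ [ c , d ] = inst (val ∘ All.lookup (All.++⁺ c d)) ψ

  data GeneratedAssumption (Is : List Interface) : Sentence → Set₁ where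
    generated : ∀ {J} → J ∈ Is → ∀ {c d} → Returns (oracle J) c d →
                GeneratedAssumption Is (assumption J [ c , d ])

  data GeneratedConstraint (Is : List Interface) : Sentence → Set₁ where
    generated : ∀ {J} → J ∈ Is → ∀ {c d} → Returns (oracle J) c d →
                GeneratedConstraint Is (constraint J [ c , d ])

  definition : (θ : Symbol) → Oracle (dom θ) (cod θ ∷ []) → Interface
  definition θ o = record
    { query      = dom θ
    ; response   = cod θ ∷ []
    ; assumption = sym θ (All.tabulate (λ i → var (∈-++⁺ˡ i)))
                   ≈ var (∈-++⁺ʳ (dom θ) (here refl))
    ; constraint = ⊤
    ; oracle     = o
    }

  data Defines (θ : Symbol) : Interface → Set₁ where
    defines : (o : Oracle (dom θ) (cod θ ∷ [])) → Functional o →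
              Defines θ (definition θ o)

  EmptyAssumption : Interface → Set
  EmptyAssumption J = assumption J ≡ ⊤

  record SMTO : Set₁ where
    constructor smto
    field
      ordinary      : List Symbol
      oracleSymbols : List Symbol
      formula       : Sentence
      interfaces    : List Interface

  record WellFormedSMTO (P : SMTO) : Set where
    open SMTO P
    field
      distinct-symbols : Unique (ordinary ++ oracleSymbols)
      formula-symbols  : AllSymbols (_∈ ordinary ++ oracleSymbols) formula

  Unsatisfiable : SMTO → Set₁
  Unsatisfiable (smto gs θs ρ Is) =
    Σ[ A ∈ List Sentence ] Σ[ B ∈ List Sentence ]
      All (GeneratedAssumption Is) A ×
      All (GeneratedConstraint Is) B ×
      ¬ ∃Satisfiable (gs ++ θs) (⋀ A ∧ ρ ∧ ⋀ B)

  Definitional : SMTO → Set₁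
  Definitional P = Pointwise Defines (SMTO.oracleSymbols P) (SMTO.interfaces P)

  asValue : ∀ {Γ s} → Term Γ s → Maybe (Value s)
  asValue (val c) = just c
  asValue _       = nothing

  asValues : ∀ {Γ as} → Args Γ as → Maybe (Values as)
  asValues []       = just []
  asValues (t ∷ ts) = zipWith _∷_ (asValue t) (asValues ts)

  asTruth : ∀ {Γ} → Formula Γ → Maybe Bool
  asTruth (truth b) = just b
  asTruth _         = nothing

  evalEq : ∀ {s} → Value s → Value s → Bool
  evalEq c d = does (c ≟ᵛ d)

  mutual
    ⟨_⟩ᵗ : ∀ {Γ s} → Term Γ s → Term Γ s
    ⟨ var i ⟩ᵗ    = var i
    ⟨ val c ⟩ᵗ    = val c
    ⟨ app o ts ⟩ᵗ = maybe′ val (app o ⟨ ts ⟩ᵃ) (asValues ⟨ ts ⟩ᵃ >>= evalOp o)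
    ⟨ sym f ts ⟩ᵗ = sym f ⟨ ts ⟩ᵃ

    ⟨_⟩ᵃ : ∀ {Γ as} → Args Γ as → Args Γ as
    ⟨ [] ⟩ᵃ     = []
    ⟨ t ∷ ts ⟩ᵃ = ⟨ t ⟩ᵗ ∷ ⟨ ts ⟩ᵃ

  ⟨_⟩ : ∀ {Γ} → Formula Γ → Formula Γ
  ⟨ truth b ⟩      = truth b
  ⟨ pred p ts ⟩    = maybe′ truth (pred p ⟨ ts ⟩ᵃ) (asValues ⟨ ts ⟩ᵃ >>= evalPred p)
  ⟨ t ≈ u ⟩        = maybe′ truth (⟨ t ⟩ᵗ ≈ ⟨ u ⟩ᵗ)
                       (zipWith evalEq (asValue ⟨ t ⟩ᵗ) (asValue ⟨ u ⟩ᵗ))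
  ⟨ neg φ ⟩        = maybe′ (truth ∘ not) (neg ⟨ φ ⟩) (asTruth ⟨ φ ⟩)
  ⟨ binary k φ ψ ⟩ = maybe′ truth (binary k ⟨ φ ⟩ ⟨ ψ ⟩)
                       (zipWith (applyᵇ k) (asTruth ⟨ φ ⟩) (asTruth ⟨ ψ ⟩))
  ⟨ quant q s φ ⟩  = quant q s ⟨ φ ⟩

  module Replace (θ : Symbol) (c : Values (dom θ))
                 (u : ∀ {Γ} → Term Γ (cod θ)) where
    mutual
      data _⟶ᵗ_ {Γ} : ∀ {s} → Term Γ s → Term Γ s → Set where
        redex  : sym θ (constants c) ⟶ᵗ u
        in-app : ∀ {as s} {o : Op as s} {ts ts′} → ts ⟶ᵃ ts′ → app o ts ⟶ᵗ app o ts′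
        in-sym : ∀ {f ts ts′} → ts ⟶ᵃ ts′ → sym f ts ⟶ᵗ sym f ts′

      data _⟶ᵃ_ {Γ} : ∀ {as} → Args Γ as → Args Γ as → Set where
        in-head : ∀ {s as t t′} {ts : Args Γ as} → t ⟶ᵗ t′ →
                  _⟶ᵃ_ {as = s ∷ as} (t ∷ ts) (t′ ∷ ts)
        in-tail : ∀ {s as ts ts′} {t : Term Γ s} → ts ⟶ᵃ ts′ →
                  _⟶ᵃ_ {as = s ∷ as} (t ∷ ts) (t ∷ ts′)

    data _⟶_ {Γ} : Formula Γ → Formula Γ → Set where
      in-pred  : ∀ {as} {p : Pred as} {ts ts′} → ts ⟶ᵃ ts′ → pred p ts ⟶ pred p ts′
      in-≈ˡ    : ∀ {s} {t t′ v : Term Γ s} → t ⟶ᵗ t′ → (t ≈ v) ⟶ (t′ ≈ v)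
      in-≈ʳ    : ∀ {s} {t v v′ : Term Γ s} → v ⟶ᵗ v′ → (t ≈ v) ⟶ (t ≈ v′)
      in-neg   : ∀ {φ φ′} → φ ⟶ φ′ → neg φ ⟶ neg φ′
      in-left  : ∀ {k φ φ′ ψ} → φ ⟶ φ′ → binary k φ ψ ⟶ binary k φ′ ψ
      in-right : ∀ {k φ ψ ψ′} → ψ ⟶ ψ′ → binary k φ ψ ⟶ binary k φ ψ′
      in-quant : ∀ {q s φ φ′} → φ ⟶ φ′ → quant q s φ ⟶ quant q s φ′

  _[_⟨_⟩↦_]≔_ : Sentence → (θ : Symbol) → Values (dom θ) → Value (cod θ) → Sentence → Set
  μ [ θ ⟨ c ⟩↦ d ]≔ μ′ = Replace._⟶_ θ c (val d) μ μ′

  Contains : (θ : Symbol) → Values (dom θ) → Sentence → Set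
  Contains θ c μ = ∃[ μ′ ] Replace._⟶_ θ c (sym θ (constants c)) μ μ′

  -- What a solver model says about a symbol: a function built from interpreted
  -- symbols only, and an actual value if the symbol is nullary.
  record FunctionValue (g : Symbol) : Set where
    field
      function : Lambda [] g
      nullary  : dom g ≡ [] → ∃[ c ] body function ≡ val c

  functions : ∀ {gs} → All FunctionValue gs → All (Lambda []) gs
  functions = All.map FunctionValue.function

  -- m is the restriction to gs of a T-model of ψ.
  HasModel : Sentence → (gs : List Symbol) → All FunctionValue gs → Set₁
  HasModel ψ gs m =
    Σ[ M ∈ Structure 𝒮 ] Model M × (Σ[ I ∈ Interpretation M ]
      (M , I ⊨ ψ) ×
      (∀ {g} (g∈gs : g ∈ gs) as →
         I g as ≡ Semantics.⟦_⟧ᵗ M I (body (All.lookup (functions m) g∈gs)) as))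

  -- The oracle of the interface J_i paired with θ_i.
  Calls : ∀ {θs Js θ} → Pointwise Defines θs Js → θ ∈ θs →
          Values (dom θ) → Value (cod θ) → Set
  Calls (_ ∷ ds)          (there i)   c d = Calls ds i c d
  Calls (defines o _ ∷ _) (here refl) c d = Returns o c (d ∷ [])

  entry : (θ : Symbol) → Values (dom θ) → Value (cod θ) → Sentence
  entry θ c d = sym θ (constants c) ≈ val d

  -- `Resolve D A μ A′ μ′`: the inner loop, started with assumptions A and
  -- formula μ, ends with A′ and μ′.
  data Resolve {θs Js} (D : Pointwise Defines θs Js) (A : List Sentence) (μ : Sentence) :
               List Sentence → Sentence → Set₁ where
    stop  : (∀ {θ} → θ ∈ θs → ∀ c → ¬ Contains θ c μ) → Resolve D A μ A μ
    known : ∀ {θ c d μ′ A″ μ″} → θ ∈ θs →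
            entry θ c d ∈ A →
            μ [ θ ⟨ c ⟩↦ d ]≔ μ′ →
            Resolve D A ⟨ μ′ ⟩ A″ μ″ → Resolve D A μ A″ μ″
    call  : ∀ {θ c d μ′ A″ μ″} (i : θ ∈ θs) →
            (∀ d′ → entry θ c d′ ∉ A) → Calls D i c d →
            μ [ θ ⟨ c ⟩↦ d ]≔ μ′ →
            Resolve D (A ++ entry θ c d ∷ []) ⟨ μ′ ⟩ A″ μ″ → Resolve D A μ A″ μ″

  data SMTOResult (gs : List Symbol) : Set where
    unsat : List Sentence → SMTOResult gs
    sat   : List Sentence → All FunctionValue gs → SMTOResult gs

  data SMTOLoop (P : SMTO) (D : Definitional P) (A : List Sentence) :
                SMTOResult (SMTO.ordinary P) → Set₁ where
    return-unsat : ¬ Satisfiable (SMTO.formula P ∧ ⋀ A) → SMTOLoop P D A (unsat A)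
    return-sat   : ∀ {m A′ μ} →
                   HasModel (SMTO.formula P ∧ ⋀ A) (SMTO.ordinary P) m →
                   Resolve D A ⟨ SMTO.formula P · functions m ⟩ A′ μ →
                   μ ≡ ⊤ → SMTOLoop P D A (sat A′ m)
    repeat       : ∀ {m A′ μ r} →
                   HasModel (SMTO.formula P ∧ ⋀ A) (SMTO.ordinary P) m →
                   Resolve D A ⟨ SMTO.formula P · functions m ⟩ A′ μ →
                   μ ≢ ⊤ → SMTOLoop P D A′ r → SMTOLoop P D A r

  Algorithm1 : (P : SMTO) → Definitional P → SMTOResult (SMTO.ordinary P) → Set₁
  Algorithm1 P D r = SMTOLoop P D [] r

  record SyMO : Set₁ where
    constructor symo
    field
      toSynthesize  : List Symbol
      oracleSymbols : List Symbol
      variables     : List Symbol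
      specification : Sentence
      interfaces    : List Interface

    Candidate : Set
    Candidate = All (Lambda oracleSymbols) toSynthesize

  -- The generators of an interface have no free variables besides y⃗ and z⃗, so
  -- in particular none of x⃗; they may mention f⃗ and θ⃗.
  record WellFormedSyMO (P : SyMO) : Set₁ where
    open SyMO P
    field
      distinct-symbols      : Unique (toSynthesize ++ variables ++ oracleSymbols)
      variables-nullary     : All (λ x → dom x ≡ []) variables
      quantifier-free       : QuantifierFree specification
      specification-symbols : AllSymbols (_∈ toSynthesize ++ variables ++ oracleSymbols)
                                         specification
      generator-variables   : All (λ J → AllSymbols (_∉ variables) (assumption J) ×
                                         AllSymbols (_∉ variables) (constraint J))
                                  interfaces

  verification : (P : SyMO) → SyMO.Candidate P → SMTO
  verification (symo fs θs xs φ Is) f* = smto xs θs (neg φ · f*) Is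

  IsSolution : (P : SyMO) → SyMO.Candidate P → Set₁
  IsSolution P f* = Unsatisfiable (verification P f*)

  private
    module _ {P Q : Symbol → Set} (P⇒Q : ∀ {f} → P f → Q f) where
      mutual
        mapᵗ : ∀ {Γ s} (t : Term Γ s) → AllSymbolsᵗ P t → AllSymbolsᵗ Q t
        mapᵗ (var i)    _        = _
        mapᵗ (val c)    _        = _
        mapᵗ (app o ts) ps       = mapᵃ ts ps
        mapᵗ (sym f ts) (p , ps) = P⇒Q p , mapᵃ ts ps

        mapᵃ : ∀ {Γ as} (ts : Args Γ as) → AllSymbolsᵃ P ts → AllSymbolsᵃ Q ts
        mapᵃ []       _        = _
        mapᵃ (t ∷ ts) (p , ps) = mapᵗ t p , mapᵃ ts ps

    module _ {P : Symbol → Set} where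
      lookupᵃ : ∀ {Γ as s} (ts : Args Γ as) → AllSymbolsᵃ P ts → (i : s ∈ as) →
                AllSymbolsᵗ P (All.lookup ts i)
      lookupᵃ (t ∷ ts) (p , _)  (here refl) = p
      lookupᵃ (t ∷ ts) (_ , ps) (there i)   = lookupᵃ ts ps i

      module _ {Γ Δ} {σ : ∀ {s} → s ∈ Γ → Term Δ s}
               (pσ : ∀ {s} (i : s ∈ Γ) → AllSymbolsᵗ P (σ i)) where
        mutual
          inst-symbolsᵗ : ∀ {s} (t : Term Γ s) → AllSymbolsᵗ P t → AllSymbolsᵗ P (instᵗ σ t)
          inst-symbolsᵗ (var i)    _        = pσ i
          inst-symbolsᵗ (val c)    _        = _
          inst-symbolsᵗ (app o ts) ps       = inst-symbolsᵃ ts ps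
          inst-symbolsᵗ (sym f ts) (p , ps) = p , inst-symbolsᵃ ts ps

          inst-symbolsᵃ : ∀ {as} (ts : Args Γ as) → AllSymbolsᵃ P ts →
                          AllSymbolsᵃ P (instᵃ σ ts)
          inst-symbolsᵃ []       _        = _
          inst-symbolsᵃ (t ∷ ts) (p , ps) = inst-symbolsᵗ t p , inst-symbolsᵃ ts ps

    module _ {fs xs θs : List Symbol} (σ : All (Lambda θs) fs) where
      mutual
        subst-symbolsᵗ : ∀ {Γ s} (t : Term Γ s) → AllSymbolsᵗ (_∈ fs ++ xs ++ θs) t →
                         AllSymbolsᵗ (_∈ xs ++ θs) (substᵗ σ t)
        subst-symbolsᵗ (var i)    _        = _
        subst-symbolsᵗ (val c)    _        = _
        subst-symbolsᵗ (app o ts) ps       = subst-symbolsᵃ ts ps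
        subst-symbolsᵗ (sym g ts) (p , ps) with g ∈? fs
        ... | yes g∈fs = inst-symbolsᵗ (lookupᵃ (substᵃ σ ts) (subst-symbolsᵃ ts ps))
                           (body f) (mapᵗ (∈-++⁺ʳ xs) (body f) (scoped f))
          where f = All.lookup σ g∈fs
        ... | no  g∉fs with ∈-++⁻ fs p
        ...   | inj₁ g∈fs = contradiction g∈fs g∉fs
        ...   | inj₂ g∈   = g∈ , subst-symbolsᵃ ts ps

        subst-symbolsᵃ : ∀ {Γ as} (ts : Args Γ as) → AllSymbolsᵃ (_∈ fs ++ xs ++ θs) ts →
                         AllSymbolsᵃ (_∈ xs ++ θs) (substᵃ σ ts)
        subst-symbolsᵃ []       _        = _
        subst-symbolsᵃ (t ∷ ts) (p , ps) = subst-symbolsᵗ t p , subst-symbolsᵃ ts ps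

      subst-symbols : ∀ {Γ} (φ : Formula Γ) → AllSymbols (_∈ fs ++ xs ++ θs) φ →
                      AllSymbols (_∈ xs ++ θs) (φ · σ)
      subst-symbols (truth b)      _       = _
      subst-symbols (pred p ts)    ps      = subst-symbolsᵃ ts ps
      subst-symbols (t ≈ u)        (p , q) = subst-symbolsᵗ t p , subst-symbolsᵗ u q
      subst-symbols (neg φ)        p       = subst-symbols φ p
      subst-symbols (binary _ φ ψ) (p , q) = subst-symbols φ p , subst-symbols ψ q
      subst-symbols (quant _ _ φ)  p       = subst-symbols φ p

    drop-unique : ∀ (fs : List Symbol) {gs} → Unique (fs ++ gs) → Unique gs
    drop-unique []       u       = u
    drop-unique (_ ∷ fs) (_ ∷ u) = drop-unique fs u

  verification-wellFormed : ∀ {P} → WellFormedSyMO P → ∀ f* →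
                            WellFormedSMTO (verification P f*)
  verification-wellFormed {P} wf f* = record
    { distinct-symbols = drop-unique (SyMO.toSynthesize P) distinct-symbols
    ; formula-symbols  = subst-symbols f* (SyMO.specification P) specification-symbols
    }
    where open WellFormedSyMO wf

  data SyMOResult (Candidate : Set) : Set where
    no-solution : SyMOResult Candidate
    return      : Candidate → SyMOResult Candidate

  module _ (fs θs xs : List Symbol) (φ : Sentence)
           {Js : List Interface} (D : Pointwise Defines θs Js)
           (Is : List Interface) where

    private
      Candidate : Set
      Candidate = All (Lambda θs) fs

      -- The oracle symbols in S, if any, are uninterpreted here.
      Satisfies : Candidate → List Sentence → Set₁
      Satisfies f* S = Satisfiable (⋀ S · f*)

      Verify : List Sentence → Candidate → SMTOResult xs → Set₁
      Verify A f* = Algorithm1 (smto xs θs ((⋀ A ∧ neg φ) · f*) Js) D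

    data SyMOLoop (A S : List Sentence) : SyMOResult Candidate → Set₁ where
      none   : ¬ (∃[ f* ] Satisfies f* S) → SyMOLoop A S no-solution
      found  : ∀ {f* α} → Satisfies f* S → Verify A f* (unsat α) →
               SyMOLoop A S (return f*)
      refine : ∀ {f* α m β r} → Satisfies f* S → Verify A f* (sat α m) →
               All (GeneratedConstraint Is) β →
               SyMOLoop (A ++ α) (S ++ φ · functions m ∷ β) r →
               SyMOLoop A S r

    Algorithm2 : SyMOResult Candidate → Set₁
    Algorithm2 r = SyMOLoop [] [] r

{-# OPTIONS --safe #-}

-- Every assumption the two algorithms ever record is an equation θ(c) ≈ d that an
-- oracle of J⃗ has returned, hence a generated assumption.  None of them mentions f⃗,
-- so substituting f⃗* leaves them unchanged, and the formula refuted by the last SMT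
-- call is implied by the recorded assumptions together with ¬φ·{f⃗ → f⃗*}.

module Submission where

open import Defs
open import Data.List using (List; []; _∷_; _++_)
open import Data.List.Membership.Propositional using (_∈_; _∉_)
open import Data.List.Membership.Propositional.Properties using (∈-++⁺ˡ; ∈-++⁺ʳ)
import Data.List.Membership.DecPropositional as DecMembership
open import Data.List.Relation.Unary.All as All using (All; []; _∷_)
import Data.List.Relation.Unary.All.Properties as All
open import Data.List.Relation.Unary.Any using (here; there)
open import Data.List.Relation.Unary.Unique.Propositional using (Unique; _∷_)
open import Data.List.Relation.Binary.Pointwise using (Pointwise; []; _∷_)
open import Data.Product using (_×_; _,_)
open import Function using (_∘_)
open import Relation.Binary.PropositionalEquality
  using (_≡_; refl; cong; cong₂; subst) renaming (sym to ≡-sym)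
open import Relation.Nullary using (¬_; yes; no; contradiction)

module _ {A : Set} {P : A → Set} where

  lookup-++⁺ˡ : ∀ {xs ys x} (ps : All P xs) (qs : All P ys) (i : x ∈ xs) →
                All.lookup (All.++⁺ ps qs) (∈-++⁺ˡ i) ≡ All.lookup ps i
  lookup-++⁺ˡ (p ∷ ps) qs (here refl) = refl
  lookup-++⁺ˡ (p ∷ ps) qs (there i)   = lookup-++⁺ˡ ps qs i

  lookup-++⁺ʳ : ∀ {xs ys x} (ps : All P xs) (qs : All P ys) (i : x ∈ ys) →
                All.lookup (All.++⁺ ps qs) (∈-++⁺ʳ xs i) ≡ All.lookup qs i
  lookup-++⁺ʳ []       qs i = refl
  lookup-++⁺ʳ (p ∷ ps) qs i = lookup-++⁺ʳ ps qs i

unique-++⇒∉ : ∀ {A : Set} (xs : List A) {ys x} → Unique (xs ++ ys) → x ∈ ys → x ∉ xs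
unique-++⇒∉ (_ ∷ xs) (≢s ∷ _) x∈ys (here refl)  =
  All.lookup ≢s (∈-++⁺ʳ xs x∈ys) refl
unique-++⇒∉ (_ ∷ xs) (_ ∷ u)  x∈ys (there x∈xs) = unique-++⇒∉ xs u x∈ys x∈xs

module _ {𝒮 : Signature} (𝒯 : Theory 𝒮) (𝒴 : Symbols 𝒮) where

  open SMO 𝒯 𝒴
  open DecMembership _≟ˢ_ using (_∈?_)

  -- The family `t` is arbitrary, not just the query variables, because the induction on `c`
  -- replaces it by `t ∘ there`.
  instᵃ-tabulate : ∀ {Γ Δ as} (σ : ∀ {s} → s ∈ Γ → Term Δ s)
                   (t : ∀ {s} → s ∈ as → Term Γ s) (c : Values as) →
                   (∀ {s} (i : s ∈ as) → instᵗ σ (t i) ≡ val (All.lookup c i)) →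
                   instᵃ σ (All.tabulate t) ≡ constants c
  instᵃ-tabulate σ t []      eq = refl
  instᵃ-tabulate σ t (_ ∷ c) eq =
    cong₂ _∷_ (eq (here refl)) (instᵃ-tabulate σ (t ∘ there) c (eq ∘ there))

  -- Instantiation replaces the query variables by `c` and the response variable by `d`, so the two
  -- sentences agree syntactically, not merely up to equivalence.
  definition-entry : ∀ {θ} (o : Oracle (dom θ) (cod θ ∷ [])) c d →
                     assumption (definition θ o) [ c , d ∷ [] ] ≡ entry θ c d
  definition-entry {θ} o c d =
    cong₂ (λ ts u → sym θ ts ≈ u)
      (instᵃ-tabulate _ _ c (cong val ∘ lookup-++⁺ˡ c (d ∷ [])))
      (cong val (lookup-++⁺ʳ c (d ∷ []) (here refl)))

  substᵃ-constants : ∀ {Δ fs Γ as} (σ : All (Lambda Δ) fs) (c : Values as) →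
                     substᵃ σ (constants {Γ} c) ≡ constants c
  substᵃ-constants σ []      = refl
  substᵃ-constants σ (v ∷ c) = cong (val v ∷_) (substᵃ-constants σ c)

  -- The only symbol of an entry is `θ`, and its arguments are values, so the substitution finds
  -- nothing to replace.
  entry-· : ∀ {Δ fs θ} (σ : All (Lambda Δ) fs) c d → θ ∉ fs →
            entry θ c d · σ ≡ entry θ c d
  entry-· {fs = fs} {θ} σ c d θ∉fs with θ ∈? fs
  ... | yes θ∈fs = contradiction θ∈fs θ∉fs
  ... | no  _    = cong (λ ts → sym θ ts ≈ val d) (substᵃ-constants σ c)

  ⋀-++⁻ : ∀ {M} {I : Interpretation M} A {B} → M , I ⊨ ⋀ (A ++ B) →
          (M , I ⊨ ⋀ A) × (M , I ⊨ ⋀ B)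
  ⋀-++⁻ []      b       = _ , b
  ⋀-++⁻ (_ ∷ A) (a , m) with as , b ← ⋀-++⁻ A m = (a , as) , b

  calls-generated : ∀ {θs Js Is θ c d} (D : Pointwise Defines θs Js) (i : θ ∈ θs) →
                    Calls D i c d → GeneratedAssumption (Js ++ Is) (entry θ c d)
  calls-generated {c = c} {d} (defines o _ ∷ _) (here refl) r =
    subst (GeneratedAssumption _) (definition-entry o c d) (generated (here refl) r)
  calls-generated (_ ∷ D) (there i) r = weaken (calls-generated D i r)
    where
    weaken : ∀ {J Ks ψ} → GeneratedAssumption Ks ψ → GeneratedAssumption (J ∷ Ks) ψ
    weaken (generated J∈Ks r) = generated (there J∈Ks) r

  module _ {θs : List Symbol} {Js : List Interface} (D : Pointwise Defines θs Js) where

    -- The loop invariant. It keeps the shape of an entry, which invariance under substitution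
    -- needs, together with the oracle call, which makes the entry a generated assumption.
    data Answer : Sentence → Set where
      answer : ∀ {θ c d} (i : θ ∈ θs) → Calls D i c d → Answer (entry θ c d)

    answer-generated : ∀ {Is ψ} → Answer ψ → GeneratedAssumption (Js ++ Is) ψ
    answer-generated (answer i r) = calls-generated D i r

    ⋀-answers-· : ∀ {Δ fs} (σ : All (Lambda Δ) fs) → (∀ {θ} → θ ∈ θs → θ ∉ fs) →
                  ∀ {A} → All Answer A → ⋀ A · σ ≡ ⋀ A
    ⋀-answers-· σ θ∉fs []                           = refl
    ⋀-answers-· σ θ∉fs (answer {c = c} {d} i _ ∷ as) =
      cong₂ (binary and) (entry-· σ c d (θ∉fs i)) (⋀-answers-· σ θ∉fs as)

    -- Only `call` extends the list, and its premises are exactly what `answer` requires.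
    resolve-answers : ∀ {A μ A′ μ′} → Resolve D A μ A′ μ′ → All Answer A → All Answer A′
    resolve-answers (stop _)         as = as
    resolve-answers (known _ _ _ R)  as = resolve-answers R as
    resolve-answers (call i _ r _ R) as = resolve-answers R (All.++⁺ as (answer i r ∷ []))

    assumptions : ∀ {gs} → SMTOResult gs → List Sentence
    assumptions (unsat A) = A
    assumptions (sat A _) = A

    smto-answers : ∀ {gs ρ A r} → SMTOLoop (smto gs θs ρ Js) D A r → All Answer A →
                   All Answer (assumptions r)
    smto-answers (return-unsat _)   as = as
    smto-answers (return-sat _ R _) as = resolve-answers R as
    smto-answers (repeat _ R _ L)   as = smto-answers L (resolve-answers R as)

    -- The assumptions returned with UNSAT are those of the last solver call, whatever list `A` the
    -- loop had at an earlier iteration.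
    smto-unsat : ∀ {gs ρ A α} → SMTOLoop (smto gs θs ρ Js) D A (unsat α) →
                 ¬ Satisfiable (binary and ρ (⋀ α))
    smto-unsat (return-unsat ¬s) = ¬s
    smto-unsat (repeat _ _ _ L)  = smto-unsat L

    -- Induction on the refinement rounds, with `All Answer A` as invariant.
    symo-sound : ∀ {fs xs φ Is A S f*} → (∀ {θ} → θ ∈ θs → θ ∉ fs) → All Answer A →
                 SyMOLoop fs θs xs φ D Is A S (return f*) →
                 IsSolution (symo fs θs xs φ (Js ++ Is)) f*
    symo-sound {A = A} {f* = f*} θ∉fs as (found {α = α} _ L) =
      -- The witnesses are the answers of all earlier rounds followed by those of the final
      -- verification run, which itself starts from the empty list; no constraints are chosen.
      A ++ α , [] , All.map answer-generated (All.++⁺ as (smto-answers L [])) , [] ,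
      -- `I` is the reinterpretation provided by the second-order quantifier; `Satisfiable` admits
      -- any interpretation, so `I` is passed on directly.
      λ (M , M-model , _ , I , _ , A++α , ¬φ , _) →
        let a , a′ = ⋀-++⁻ {I = I} A A++α in
        -- In the refuted formula `f*` is substituted into `⋀ A` and `neg φ` but not into `⋀ α`, so
        -- only the truth of `⋀ A` has to be transported.
        smto-unsat L (M , M-model , I ,
          (subst (M , I ⊨_) (≡-sym (⋀-answers-· f* θ∉fs as)) a , ¬φ) , a′)
    symo-sound θ∉fs as (refine _ L _ K) =
      symo-sound θ∉fs (All.++⁺ as (smto-answers L [])) K

mainTheorem4 : {𝒮 : Signature} (𝒯 : Theory 𝒮) (𝒴 : Symbols 𝒮) → let open SMO 𝒯 𝒴 in
    (fs θs xs : List Symbol) (φ : Sentence) (Js Is : List Interface) →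
    WellFormedSyMO (symo fs θs xs φ (Js ++ Is)) →
    (D : Pointwise Defines θs Js) →
    All EmptyAssumption Is →
    (f* : All (Lambda θs) fs) →
    Algorithm2 fs θs xs φ D Is (return f*) →
    IsSolution (symo fs θs xs φ (Js ++ Is)) f*
mainTheorem4 𝒯 𝒴 fs θs xs φ Js Is wf D _ f* run =
  symo-sound 𝒯 𝒴 D
    -- Distinctness of all symbols keeps the oracle symbols out of `fs`.
    (λ θ∈θs → unique-++⇒∉ fs distinct-symbols (∈-++⁺ʳ xs θ∈θs)) [] run
  where open SMO.WellFormedSyMO wf
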